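{- $\mathfrak{b}\leq\mathfrak{s}(\mathbb{R})$.
   Context: $\mathfrak{b}$ is the bounding number: the smallest cardinality of a family of functions $\omega\to\omega$ not bounded by a single function modulo finite (i.e. no $f$ with $g<^*f$ for all members $g$, where $g<^*f$ means $g(n)<f(n)$ for all but finitely many $n$). For infinite sets $U, A$, say $U$ splits $A$ if both $A\cap U$ and $A\setminus U$ are infinite. $\mathfrak{s}(\mathbb{R})$ is the smallest cardinality of a family $\mathcal{U}$ of open subsets of $\mathbb{R}$ (usual topology) such that every infinite $A\subseteq\mathbb{R}$ is split by some $U\in\mathcal{U}$. -}

module Defs where

open import Level using (Level; 0ℓ; suc; _⊔_)
open import Data.Nat.Base using (ℕ; _≮_)
open import Data.Rational.Base using (ℚ; _<_)
open import Data.List.Base using (List)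
import Data.List.Membership.Setoid as Membership
open import Data.Product.Base using (Σ-syntax; ∃-syntax; _×_; _,_)
open import Data.Sum.Base using (_⊎_)
open import Function.Bundles using (Injection; _⇔_; _↣_)
open import Relation.Binary.Bundles using (Setoid)
open import Relation.Binary.Definitions using (_Respects_)
open import Relation.Binary.PropositionalEquality using (setoid; _→-setoid_)
open import Relation.Nullary.Negation.Core using (¬_)
open import Relation.Unary using (Pred; _∩_; _∖_; _≐_)
open import Relation.Unary.Properties using (≐-refl; ≐-sym; ≐-trans)

private
  variable
    a ℓ p : Level

-- "Not covered by a finite list" rather than "contains a sequence of distinct
-- elements", so that infiniteness does not depend on any choice principle.
Finite : (S : Setoid a ℓ) → Pred (Setoid.Carrier S) p → Set (a ⊔ ℓ ⊔ p)
Finite S P = ∃[ xs ] (∀ {x} → P x → x ∈ xs)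
  where open Membership S using (_∈_)

Infinite : (S : Setoid a ℓ) → Pred (Setoid.Carrier S) p → Set (a ⊔ ℓ ⊔ p)
Infinite S P = ¬ Finite S P

-- A set of elements of S having cardinality I, enumerated without repetition.
Family : Set → Setoid a ℓ → Set (a ⊔ ℓ)
Family I S = Injection (setoid I) S

-- Cardinals are represented by types, compared by injections.
record IsLeastCardinality (P : Set → Set ℓ) (κ : Set) : Set (suc 0ℓ ⊔ ℓ) where
  field
    attained : P κ
    least    : ∀ {I : Set} → P I → κ ↣ I

Baire : Setoid 0ℓ 0ℓ
Baire = ℕ →-setoid ℕ

_<*_ : (ℕ → ℕ) → (ℕ → ℕ) → Set
g <* f = Finite (setoid ℕ) (λ n → g n ≮ f n)

Unbounded : {I : Set} → Family I Baire → Set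
Unbounded {I} G = ¬ (∃[ f ] (∀ (i : I) → Injection.to G i <* f))

IsBoundingNumber : Set → Set₁
IsBoundingNumber =
  IsLeastCardinality (λ I → Σ[ G ∈ Family I Baire ] Unbounded G)

-- Two-sided Dedekind cuts: lower q means q < x, and upper q means x < q.
record ℝ : Set₁ where
  field
    lower upper     : Pred ℚ 0ℓ
    lower-inhabited : ∃[ q ] lower q
    upper-inhabited : ∃[ q ] upper q
    lower-rounded   : ∀ {q} → lower q ⇔ (∃[ r ] q < r × lower r)
    upper-rounded   : ∀ {q} → upper q ⇔ (∃[ r ] r < q × upper r)
    disjoint        : ∀ {q} → ¬ (lower q × upper q)
    located         : ∀ {q r} → q < r → lower q ⊎ upper r

open ℝ

_≈_ : ℝ → ℝ → Set
x ≈ y = lower x ≐ lower y × upper x ≐ upper y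

ℝ-setoid : Setoid (suc 0ℓ) 0ℓ
ℝ-setoid = record
  { Carrier       = ℝ
  ; _≈_           = _≈_
  ; isEquivalence = record
    { refl  = ≐-refl , ≐-refl
    ; sym   = λ (l , u) → ≐-sym l , ≐-sym u
    ; trans = λ (l , u) (l′ , u′) → ≐-trans l l′ , ≐-trans u u′
    }
  }

record Subset : Set₁ where
  field
    mem      : Pred ℝ 0ℓ
    respects : mem Respects _≈_

open Subset

Interval : ℚ → ℚ → Pred ℝ 0ℓ
Interval q r x = lower x q × upper x r

-- The usual topology, through its base of intervals with rational endpoints.
IsOpen : Pred ℝ 0ℓ → Set₁
IsOpen U = ∀ {x} → U x →
  ∃[ q ] ∃[ r ] Interval q r x × (∀ {y} → Interval q r y → U y)

record Open : Set₁ where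
  field
    subset : Subset
    isOpen : IsOpen (mem subset)

  points : Pred ℝ 0ℓ
  points = mem subset

open Open using (points)

Open-setoid : Setoid (suc 0ℓ) (suc 0ℓ)
Open-setoid = record
  { Carrier       = Open
  ; _≈_           = λ U V → points U ≐ points V
  ; isEquivalence = record { refl = ≐-refl ; sym = ≐-sym ; trans = ≐-trans }
  }

_Splits_ : Pred ℝ 0ℓ → Pred ℝ 0ℓ → Set₁
U Splits A = Infinite ℝ-setoid (A ∩ U) × Infinite ℝ-setoid (A ∖ U)

Splitting : {I : Set} → Family I Open-setoid → Set₁
Splitting {I} 𝒰 = ∀ (A : Subset) → Infinite ℝ-setoid (mem A) →
  ∃[ i ] points (Injection.to 𝒰 i) Splits mem A

IsSplittingNumberℝ : Set → Set₁
IsSplittingNumberℝ =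
  IsLeastCardinality (λ I → Σ[ 𝒰 ∈ Family I Open-setoid ] Splitting 𝒰)

{-# OPTIONS --safe #-}
-- Enumerate ℚ. For open U let g_U(c) be so large that, if the c-th rational x
-- lies in U, then so does x + 1/(m+1) for every m ≥ g_U(c). If f eventually
-- dominates every g_U of a family, build rationals x₀ < x₁ < … by
-- xₖ₊₁ = xₖ + 1/(f(cₖ)+1), where cₖ is the index of xₖ. For each U and all large k,
-- xₖ ∈ U implies xₖ₊₁ ∈ U, so {xₖ} is not split by U. Hence a splitting family
-- yields an unbounded family (g_U); to keep its indexing injective without
-- choice, g_U also records which rational intervals are contained in U.
module Submission where

open import Level using (lift; 0ℓ; suc) renaming (lower to unlift)
open import Axiom.ExcludedMiddle using (ExcludedMiddle)
open import Data.Bool.Base using (if_then_else_)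
open import Data.Fin.Base using (toℕ)
open import Data.Fin.Properties using (pigeonhole)
open import Data.Integer.Base using (ℤ; +_; -[1+_]; _⊖_; +<+; +[1+_])
open import Data.List.Base using ([]; _∷_; length; lookup; map; upTo)
open import Data.List.Membership.Propositional using (_∈_; _∉_)
open import Data.List.Membership.Propositional.Properties using (∈-upTo⁺)
open import Data.List.Relation.Unary.Any as Any using (here; there)
import Data.List.Relation.Unary.Any.Properties as Any
open import Data.Nat.Base as ℕ using (ℕ; zero; _%_; s≤s)
import Data.Nat.Properties as ℕ
open import Data.Nat.Coprimality using (1-coprimeTo)
open import Data.Nat.DivMod using ([m+kn]%n≡m%n)
open import Data.Product.Base using (∃-syntax; _×_; _,_; proj₁; proj₂)
open import Data.Product.Function.NonDependent.Propositional using (_×-↠_)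
open import Data.Rational.Base
  using (ℚ; mkℚ; 0ℚ; 1ℚ; _<_; _+_; -_; _/_; ↥_; ↧ₙ_; *<*)
import Data.Rational.Properties as ℚ
open import Data.Sum.Base using (inj₁; inj₂)
open import Function.Base using (_∘_)
open import Function.Bundles
  using (Injection; Surjection; _↣_; _↠_; mk⇔; mk↠ₛ)
open import Function.Properties.Surjection using ()
  renaming (refl to ↠-refl; trans to ↠-trans)
open import Relation.Binary.Bundles using (Setoid)
open import Relation.Binary.Definitions using (_Respects_; tri<; tri≈; tri>)
open import Relation.Binary.PropositionalEquality
  using (_≡_; _≗_; refl; sym; trans; cong; subst)
open import Relation.Nullary.Decidable using (Dec; yes; no; does; map′; decidable-stable)
open import Relation.Nullary.Negation using (¬_; contradiction)
open import Relation.Unary using (Pred; _∩_)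
import Algebra.Properties.Group as Group

open import Defs

-- Enumerating pairs of rationals.

nextPair : ℕ × ℕ → ℕ × ℕ
nextPair (zero    , b) = ℕ.suc b , zero
nextPair (ℕ.suc a , b) = a , ℕ.suc b

pair : ℕ → ℕ × ℕ
pair zero      = zero , zero
pair (ℕ.suc n) = nextPair (pair n)

-- The walk runs down each antidiagonal from `(s , 0)` to `(0 , s)` and then jumps to the next, so
-- the predecessor of `(suc a , 0)` is `(0 , a)` and that of `(a , suc b)` is `(suc a , b)`.
pair-reaches-diagonal : ∀ s b {a} → a ℕ.+ b ≡ s → ∃[ n ] pair n ≡ (a , b)
pair-reaches-diagonal zero zero {zero} _ = zero , refl
pair-reaches-diagonal (ℕ.suc s) zero {ℕ.suc a} eq
  with n , p ← pair-reaches-diagonal s a {zero}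
                 (ℕ.suc-injective (trans (cong ℕ.suc (sym (ℕ.+-identityʳ a))) eq))
  = ℕ.suc n , cong nextPair p
pair-reaches-diagonal s (ℕ.suc b) {a} eq
  with n , p ← pair-reaches-diagonal s b {ℕ.suc a} (trans (sym (ℕ.+-suc a b)) eq)
  = ℕ.suc n , cong nextPair p

ℕ↠ℕ×ℕ : ℕ ↠ (ℕ × ℕ)
ℕ↠ℕ×ℕ = mk↠ₛ {to = pair} λ (a , b) → pair-reaches-diagonal (a ℕ.+ b) b refl

ℕ↠ℤ : ℕ ↠ ℤ
ℕ↠ℤ = ↠-trans ℕ↠ℕ×ℕ (mk↠ₛ {to = λ (a , b) → a ⊖ b} λ
  { (+ n)    → (n , 0) , refl
  ; -[1+ n ] → (0 , ℕ.suc n) , refl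
  })

ℕ↠ℚ : ℕ ↠ ℚ
ℕ↠ℚ = ↠-trans (↠-trans ℕ↠ℕ×ℕ (ℕ↠ℤ ×-↠ ↠-refl))
  (mk↠ₛ {to = λ (i , d) → i / ℕ.suc d} λ
    { x@(mkℚ _ d _) → (↥ x , d) , ℚ.↥p/↧p≡p x })

ℕ↠ℚ×ℚ : ℕ ↠ (ℚ × ℚ)
ℕ↠ℚ×ℚ = ↠-trans ℕ↠ℕ×ℕ (ℕ↠ℚ ×-↠ ℕ↠ℚ)

interval : ℕ → ℚ × ℚ
interval = Surjection.to ℕ↠ℚ×ℚ

leftEnd : ℕ → ℚ
leftEnd = proj₁ ∘ interval

-- The degenerate pair lets one code stand both for a rational point and for a rational interval.
index : ℚ → ℕ
index x = Surjection.to⁻ ℕ↠ℚ×ℚ (x , x)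

leftEnd-index : ∀ x → leftEnd (index x) ≡ x
leftEnd-index x = cong proj₁ (Surjection.to∘to⁻ ℕ↠ℚ×ℚ (x , x))

-- Small rational steps.

1/1+ : ℕ → ℚ
1/1+ m = mkℚ (+ 1) m (1-coprimeTo (ℕ.suc m))

x<x+1/1+m : ∀ x m → x < x + 1/1+ m
x<x+1/1+m x m = subst (_< x + 1/1+ m) (ℚ.+-identityʳ x)
  (ℚ.+-monoʳ-< x (ℚ.positive⁻¹ (1/1+ m)))

-- A positive fraction has numerator at least 1, so it is at least the reciprocal of its
-- denominator.
1/1+-archimedean : ∀ {ε m} → 0ℚ < ε → ↧ₙ ε ℕ.≤ m → 1/1+ m < ε
1/1+-archimedean {mkℚ +[1+ a ] d _} {m} _ d<m = *<* (+<+ (begin-strict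
  1 ℕ.* ℕ.suc d         ≡⟨ ℕ.*-identityˡ (ℕ.suc d) ⟩
  ℕ.suc d               <⟨ s≤s d<m ⟩
  ℕ.suc m               ≤⟨ ℕ.m≤n*m (ℕ.suc m) (ℕ.suc a) ⟩
  ℕ.suc a ℕ.* ℕ.suc m   ∎))
  where open ℕ.≤-Reasoning
1/1+-archimedean {mkℚ (+ 0) _ _} (*<* (+<+ ()))
1/1+-archimedean {mkℚ -[1+ _ ] _ _} (*<* ())

x+1/1+m<r : ∀ {x r m} → x < r → ↧ₙ (- x + r) ℕ.≤ m → x + 1/1+ m < r
x+1/1+m<r {x} {r} {m} x<r le = subst (x + 1/1+ m <_)
  (Group.\\-leftDividesˡ ℚ.+-0-group x r)
  (ℚ.+-monoʳ-< x (1/1+-archimedean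
    (subst (_< - x + r) (ℚ.+-inverseˡ x) (ℚ.+-monoʳ-< (- x) x<r)) le))

-- Rational cuts and ranges of rational sequences.

fromℚ : ℚ → ℝ
fromℚ x = record
  { lower           = _< x
  ; upper           = x <_
  ; lower-inhabited = x + - 1ℚ
      , subst (x + - 1ℚ <_) (ℚ.+-identityʳ x) (ℚ.+-monoʳ-< x (ℚ.negative⁻¹ (- 1ℚ)))
  ; upper-inhabited = x + 1ℚ , x<x+1/1+m x 0
  ; lower-rounded   = mk⇔ ℚ.<-dense (λ (_ , q<r , r<x) → ℚ.<-trans q<r r<x)
  ; upper-rounded   = mk⇔ (λ x<q → let r , x<r , r<q = ℚ.<-dense x<q in r , r<q , x<r)
                          (λ (_ , r<q , x<r) → ℚ.<-trans x<r r<q)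
  ; disjoint        = λ (q<x , x<q) → ℚ.<-asym q<x x<q
  ; located         = λ {q} q<r → located q<r (q ℚ.<? x)
  }
  where
  located : ∀ {q r} → q < r → Dec (q < x) → _
  located q<r (yes q<x) = inj₁ q<x
  located q<r (no q≮x)  = inj₂ (ℚ.≤-<-trans (ℚ.≮⇒≥ q≮x) q<r)

fromℚ-<⇒≉ : ∀ {x y} → x < y → ¬ (fromℚ x ≈ fromℚ y)
fromℚ-<⇒≉ x<y ((_ , <y⇒<x) , _) = ℚ.<-irrefl refl (<y⇒<x x<y)

module ≈ = Setoid ℝ-setoid

range : (ℕ → ℚ) → Subset
range x = record
  { mem      = λ y → ∃[ k ] y ≈ fromℚ (x k)
  ; respects = λ {y} {z} y≈z (k , y≈xₖ) →
      k , ≈.trans {z} {y} {fromℚ (x k)} (≈.sym {y} {z} y≈z) y≈xₖ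
  }

module _ {x : ℕ → ℚ} (x-step : ∀ k → x k < x (ℕ.suc k)) where

  increasing : ∀ {m n} → m ℕ.< n → x m < x n
  increasing {m} {ℕ.suc n} (s≤s m≤n) with ℕ.m≤n⇒m<n∨m≡n m≤n
  ... | inj₁ m<n  = ℚ.<-trans (increasing m<n) (x-step n)
  ... | inj₂ refl = x-step n

  increasing⇒injective : ∀ {m n} → x m ≡ x n → m ≡ n
  increasing⇒injective {m} {n} eq with ℕ.<-cmp m n
  ... | tri< m<n _ _ = contradiction eq (ℚ.<⇒≢ (increasing m<n))
  ... | tri≈ _ m≡n _ = m≡n
  ... | tri> _ _ n<m = contradiction (sym eq) (ℚ.<⇒≢ (increasing n<m))

  range-infinite : Infinite ℝ-setoid (Subset.mem (range x))
  range-infinite (ys , covers) =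
    -- One more term than `ys` has entries: two terms share a position.
    let i , j , i<j , eq = pigeonhole (ℕ.n<1+n (length ys)) (Any.index ∘ position ∘ toℕ)
    in fromℚ-<⇒≉ (increasing i<j)
         (equal {fromℚ (x (toℕ i))} {fromℚ (x (toℕ j))} eq
           (Any.lookup-index (position (toℕ i)))
           (Any.lookup-index (position (toℕ j))))
    where
    position : ∀ k → Any.Any (fromℚ (x k) ≈_) ys
    position k = covers {fromℚ (x k)} (k , ≈.refl {fromℚ (x k)})

    equal : ∀ {y z i j} → i ≡ j → y ≈ lookup ys i → z ≈ lookup ys j → y ≈ z
    equal {y} {z} {i} refl y≈ z≈ = ≈.trans {y} {lookup ys i} {z} y≈ (≈.sym {z} {lookup ys i} z≈)

range∩-finite : ∀ {x n} {P : Pred ℝ 0ℓ} → P Respects _≈_ →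
  (∀ {k} → n ℕ.≤ k → ¬ P (fromℚ (x k))) →
  Finite ℝ-setoid (Subset.mem (range x) ∩ P)
range∩-finite {x} {n} {P} resp avoids = map (fromℚ ∘ x) (upTo n) , covers
  where
  covers : ∀ {y} → (Subset.mem (range x) ∩ P) y → Any.Any (y ≈_) (map (fromℚ ∘ x) (upTo n))
  covers ((k , y≈xₖ) , Py) = Any.map⁺ (Any.map (λ { refl → y≈xₖ })
    (∈-upTo⁺ (ℕ.≰⇒> λ n≤k → avoids n≤k (resp y≈xₖ Py))))

-- Storing a decision in the parity of a number.

indicator : ∀ {a} {A : Set a} → Dec A → ℕ
indicator A? = if does A? then 1 else 0

-- Reduction modulo 2 recovers the bit whatever `m` and `n` are, so equal codes force equal
-- decisions.
indicator-*2-injective : ∀ {a b} {A : Set a} {B : Set b} (A? : Dec A) (B? : Dec B) →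
  ∀ m n → indicator A? ℕ.+ m ℕ.* 2 ≡ indicator B? ℕ.+ n ℕ.* 2 → A → B
indicator-*2-injective _       (yes b) _ _ _ _ = b
indicator-*2-injective (no ¬a) (no _)  _ _ _ a = contradiction a ¬a
indicator-*2-injective (yes _) (no _)  m n eq _ = contradiction
  (trans (sym ([m+kn]%n≡m%n 1 m 2)) (trans (cong (_% 2) eq) ([m+kn]%n≡m%n 0 n 2))) λ ()

persists : {P : Pred ℕ 0ℓ} → ∀ {n} → P n → (∀ {k} → n ℕ.≤ k → P k → P (ℕ.suc k)) →
  ∀ {k} → n ℕ.≤ k → P k
persists {n = n} Pn step n≤k = go (ℕ.≤⇒≤′ n≤k)
  where
  go : ∀ {k} → n ℕ.≤′ k → _
  go ℕ.≤′-refl       = Pn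
  go (ℕ.≤′-step n≤k) = step (ℕ.≤′⇒≤ n≤k) (go n≤k)

-- Growth functions of open sets.

module _ (em : ExcludedMiddle (suc 0ℓ)) where

  em₀ : ExcludedMiddle 0ℓ
  em₀ = map′ unlift lift em

  -- Each entry of the list is hit at most once, so it suffices to go past that hit. This turns
  -- finitely many exceptional codes into finitely many exceptional stages.
  injective⇒eventually-∉ : {c : ℕ → ℕ} → (∀ {m n} → c m ≡ c n → m ≡ n) →
    ∀ xs → ∃[ n ] (∀ {k} → n ℕ.≤ k → c k ∉ xs)
  injective⇒eventually-∉ inj [] = 0 , λ _ ()
  injective⇒eventually-∉ {c} inj (x ∷ xs)
    with n , avoids ← injective⇒eventually-∉ {c} inj xs | em₀ {∃[ j ] c j ≡ x}
  ... | no never = n , λ where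
    _   (here eq) → never (_ , eq)
    n≤k (there i) → avoids n≤k i
  ... | yes (j , cⱼ≡x) = ℕ.suc j ℕ.⊔ n , λ where
    le (here eq) → ℕ.<-irrefl (inj (trans cⱼ≡x (sym eq))) (ℕ.m⊔n≤o⇒m≤o (ℕ.suc j) n le)
    le (there i) → avoids (ℕ.m⊔n≤o⇒n≤o (ℕ.suc j) n le) i

  -- A bound on the reciprocal of the distance from `x` to the right end `r` of an interval inside
  -- `U`; the value 0 off `U` is a mere default.
  radius : Open → ℚ → ℕ
  radius U x with em₀ {Open.points U (fromℚ x)}
  ... | yes x∈U = let _ , r , _ = Open.isOpen U x∈U in ↧ₙ (- x + r)
  ... | no  _   = 0

  radius-correct : ∀ U {x m} → Open.points U (fromℚ x) → radius U x ℕ.≤ m →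
    Open.points U (fromℚ (x + 1/1+ m))
  radius-correct U {x} {m} x∈U le with em₀ {Open.points U (fromℚ x)}
  ... | no  x∉U  = contradiction x∈U x∉U
  ... | yes x∈U′ =
    let _ , _ , (q<x , x<r) , inside = Open.isOpen U x∈U′
    in inside (ℚ.<-trans q<x (x<x+1/1+m x m) , x+1/1+m<r x<r le)

  -- Quantification over all cuts raises the level, hence excluded middle at `suc 0ℓ`.
  Contains : Open → ℚ × ℚ → Set₁
  Contains U (q , r) = ∀ {y} → Interval q r y → Open.points U y

  growth : Open → ℕ → ℕ
  growth U c = indicator (em {Contains U (interval c)}) ℕ.+ radius U (leftEnd c) ℕ.* 2

  radius≤growth : ∀ U c → radius U (leftEnd c) ℕ.≤ growth U c
  radius≤growth U c = ℕ.≤-trans (ℕ.m≤m*n _ 2) (ℕ.m≤n+m _ _)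

  -- An open set is the union of the rational intervals it contains, and the parities of its growth
  -- function list these.
  growth-determines : ∀ U V → growth U ≗ growth V →
    ∀ {y} → Open.points U y → Open.points V y
  growth-determines U V eq y∈U =
    let q , r , y∈qr , qr⊆U = Open.isOpen U y∈U
        c , c≡qr = Surjection.strictlySurjective ℕ↠ℚ×ℚ (q , r)
        I⊆V = indicator-*2-injective em em (radius U (leftEnd c)) (radius V (leftEnd c)) (eq c)
                (subst (Contains U) (sym c≡qr) qr⊆U)
    in subst (Contains V) c≡qr I⊆V {_} y∈qr

  growth-family : ∀ {I} → Family I Open-setoid → Family I Baire
  growth-family 𝒰 = record
    { to        = λ i → growth (to i)
    ; cong      = λ { refl _ → refl }
    ; injective = λ {i} {j} eq → injective
        ( growth-determines (to i) (to j) eq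
        , growth-determines (to j) (to i) (sym ∘ eq))
    }
    where open Injection 𝒰

  -- The increasing sequence determined by `f`.

  module _ (f : ℕ → ℕ) where

    -- The recursion runs on codes because `f` takes codes as arguments; the starting code is
    -- arbitrary.
    indices : ℕ → ℕ
    indices zero      = 0
    indices (ℕ.suc k) = index (leftEnd (indices k) + 1/1+ (f (indices k)))

    sequence : ℕ → ℚ
    sequence = leftEnd ∘ indices

    sequence-suc : ∀ k → sequence (ℕ.suc k) ≡ sequence k + 1/1+ (f (indices k))
    sequence-suc k = leftEnd-index _

    sequence-step : ∀ k → sequence k < sequence (ℕ.suc k)
    sequence-step k = subst (sequence k <_) (sym (sequence-suc k)) (x<x+1/1+m _ _)

    bounded⇒¬splits : ∀ U → growth U <* f → ¬ (Open.points U Splits Subset.mem (range sequence))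
    bounded⇒¬splits U (exceptions , covers) (∩-infinite , ∖-infinite)
      with N , avoids ← injective⇒eventually-∉ {indices}
                          -- Equal codes have equal left ends, and the sequence never repeats a
                          -- rational.
                          (increasing⇒injective sequence-step ∘ cong leftEnd) exceptions
         | em₀ {∃[ n ] N ℕ.≤ n × Open.points U (fromℚ (sequence n))}
    -- The sequence stays out of `U` from stage `N` on.
    ... | no never = ∩-infinite (range∩-finite {sequence} (Subset.respects (Open.subset U))
                       λ N≤k xₖ∈U → never (_ , N≤k , xₖ∈U))
    -- Once in `U` after stage `N`, the sequence never leaves it.
    ... | yes (n , N≤n , xₙ∈U) = ∖-infinite (range∩-finite {sequence}
            (λ {y} {z} y≈z y∉U z∈U →
              y∉U (Subset.respects (Open.subset U) (≈.sym {y} {z} y≈z) z∈U))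
            (λ n≤k xₖ∉U → xₖ∉U (persists xₙ∈U (stays ∘ ℕ.≤-trans N≤n) n≤k)))
      where
      dominated : ∀ {k} → N ℕ.≤ k → growth U (indices k) ℕ.< f (indices k)
      -- Avoiding the exceptions only refutes the failure of `<`; decidability removes the double
      -- negation.
      dominated N≤k = decidable-stable (_ ℕ.<? _) (avoids N≤k ∘ covers)

      stays : ∀ {k} → N ℕ.≤ k → Open.points U (fromℚ (sequence k)) →
              Open.points U (fromℚ (sequence (ℕ.suc k)))
      stays {k} N≤k xₖ∈U = subst (Open.points U ∘ fromℚ) (sym (sequence-suc k))
        (radius-correct U xₖ∈U (ℕ.≤-trans (radius≤growth U (indices k)) (ℕ.<⇒≤ (dominated N≤k))))

  -- From splitting families to unbounded families.

  splitting⇒unbounded : ∀ {I} (𝒰 : Family I Open-setoid) → Splitting 𝒰 →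
    Unbounded (growth-family 𝒰)
  splitting⇒unbounded 𝒰 splitting (f , bounds) =
    let i , splits = splitting (range (sequence f)) (range-infinite (sequence-step f))
    in bounded⇒¬splits f (Injection.to 𝒰 i) (bounds i) splits

theorem3p2 : ExcludedMiddle (suc 0ℓ) →
    (𝔟 𝔰ℝ : Set) → IsBoundingNumber 𝔟 → IsSplittingNumberℝ 𝔰ℝ → 𝔟 ↣ 𝔰ℝ
theorem3p2 em _ _ isBounding isSplitting =
  let 𝒰 , splitting = IsLeastCardinality.attained isSplitting
  in IsLeastCardinality.least isBounding
       (growth-family em 𝒰 , splitting⇒unbounded em 𝒰 splitting)
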